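{- Let $G$ be a finite, simple, connected bipartite graph on $\nu$ vertices and let $M$ be a perfect matching of $G$. Suppose that for any two vertices $x$ and $y$ lying in different parts of the bipartition of $G$, $d(x)+d(y)\geq \nu/2+2$. Then $G$ has an $M$-alternating Hamilton cycle.
   Context: $d(x)$ is the degree of $x$. A perfect matching $M$ is a set of pairwise non-adjacent edges covering every vertex. An $M$-alternating cycle is a cycle whose edges lie alternately in $M$ and in $E(G)\setminus M$; an $M$-alternating Hamilton cycle is such a cycle through all vertices of $G$. -}

module Defs where

open import Data.Nat using (ℕ; zero; suc; _+_; _*_; _≤_; _%_)
open import Data.Nat.DivMod using (m%n<n)
open import Data.Bool using (Bool; true; false; if_then_else_)
open import Data.Fin using (Fin; toℕ; fromℕ<)
open import Data.List using (List; allFin; map)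
open import Data.Nat.ListAction using (sum)
open import Data.Product using (Σ; ∃; _×_)
open import Relation.Binary.PropositionalEquality using (_≡_; _≢_)
open import Relation.Nullary using (¬_)
open import Function.Definitions using (Injective)
open import Function.Bundles using (_⇔_)

record Graph (ν : ℕ) : Set where
  field
    E     : Fin ν → Fin ν → Bool
    sym   : ∀ x y → E x y ≡ E y x
    loopless : ∀ x → E x x ≡ false

module _ {ν : ℕ} (G : Graph ν) where
  open Graph G

  Adj : Fin ν → Fin ν → Set
  Adj x y = E x y ≡ true

  deg : Fin ν → ℕ
  deg x = sum (map (λ y → if E x y then 1 else 0) (allFin ν))

  data Walk : Fin ν → Fin ν → Set where
    here : ∀ x → Walk x x
    step : ∀ {x y z} → Adj x y → Walk y z → Walk x z

  Connected : Set
  Connected = ∀ x y → Walk x y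

  IsBipartition : (Fin ν → Bool) → Set
  IsBipartition c = ∀ x y → Adj x y → c x ≢ c y

  record PerfectMatching (M : Fin ν → Fin ν → Bool) : Set where
    field
      M-sym    : ∀ x y → M x y ≡ M y x
      M⊆E      : ∀ x y → M x y ≡ true → Adj x y
      covers   : ∀ x → ∃ λ y → M x y ≡ true
      disjoint : ∀ x y z → M x y ≡ true → M x z ≡ true → y ≡ z

next : ∀ {k} → Fin (suc k) → Fin (suc k)
next {k} i = fromℕ< (m%n<n (suc (toℕ i)) (suc k))

record AltHamCycle {k : ℕ} (G : Graph (suc k)) (M : Fin (suc k) → Fin (suc k) → Bool) : Set where
  field
    σ         : Fin (suc k) → Fin (suc k)
    σ-inj     : Injective _≡_ _≡_ σ
    length≥3  : 3 ≤ suc k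
    edges     : ∀ i → Adj G (σ i) (σ (next i))
    alternate : ∀ i → (M (σ i) (σ (next i)) ≡ true) ⇔ (¬ (M (σ (next i)) (σ (next (next i))) ≡ true))

{-# OPTIONS --safe #-}
module Submission where

-- Orient G on one colour class: x → y when x is adjacent to the partner of y. An M-alternating
-- Hamilton cycle is a directed Hamilton cycle, and out-degrees and in-degrees are degrees minus
-- one, so with n = ν/2 the hypothesis says d⁺(x) + d⁻(y) ≥ n for all x and y.
-- Take a cycle with c vertices, and outside it a maximal path P from p to q with l vertices. Let S
-- be the set of in-neighbours of p on the cycle, and T that of out-neighbours of q. If some
-- t ∈ T comes at most l steps after some s ∈ S, replacing the vertices between them by P gives a
-- longer cycle. Otherwise no s ∈ S has its successor in T, and a closest pair s, t has at least l
-- vertices between them belonging to neither set, so |S| + |T| + l − 1 ≤ c; since every other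
-- in-neighbour of p and out-neighbour of q lies on P, this contradicts the degree condition.
-- S and T are nonempty because the ends of a maximal path have all their neighbours on the path,
-- which yields an initial cycle too long to leave room for l vertices that contain either
-- neighbourhood.

open import Defs
open import Data.Nat using (ℕ; zero; suc; _+_; _*_; _≤_; _<_; z≤n; s≤s; s≤s⁻¹; _%_)
open import Data.Nat.DivMod using (m<n⇒m%n≡m; n%n≡0; m%n<n)
open import Data.Nat.Properties hiding (_≟_)
open import Data.Nat.Tactic.RingSolver using (solve-∀)
open import Data.Nat.ListAction using (sum)
open import Data.Nat.ListAction.Properties using (sum-++; sum-↭)
open import Data.Bool using (Bool; true; false; not; if_then_else_)
import Data.Bool.Properties as Bool
import Algebra.Solver.CommutativeMonoid as CommutativeMonoidSolver
open import Data.Fin using (Fin; toℕ; cast) renaming (zero to fzero; suc to fsuc)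
open import Data.Fin.Properties using (_≟_; any?; toℕ-cast; toℕ-fromℕ<; toℕ<n; toℕ-injective)
open import Data.List using (List; []; _∷_; [_]; _++_; length; map; lookup)
open import Data.List.Properties using (map-++; map-∘; length-++; ++-identityʳ; length-tabulate)
open import Data.List.Membership.Propositional using (_∈_; _∉_)
open import Data.List.Membership.Propositional.Properties using (∈-∃++; ∈-allFin; ∈-map⁺; ∈-lookup)
open import Data.List.Relation.Unary.Any using (here; there)
open import Data.List.Relation.Unary.All as All using (All; []; _∷_)
import Data.List.Relation.Unary.All.Properties as All
open import Data.List.Relation.Unary.AllPairs using ([]; _∷_)
open import Data.List.Relation.Unary.Unique.Propositional using (Unique)
open import Data.List.Relation.Unary.Unique.Propositional.Properties using (allFin⁺)
open import Data.List.Relation.Binary.Permutation.Propositional using (_↭_; ↭-refl; ↭-trans; ↭-reflexive; ↭⇒↭ₛ)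
open import Data.List.Relation.Binary.Permutation.Propositional.Properties
  using (All-resp-↭; ∈-resp-↭; ↭-length; shift; ++-commutativeMonoid) renaming (map⁺ to ↭-map⁺; ++⁺ˡ to ↭-++⁺ˡ)
open import Data.List.Relation.Binary.Permutation.Setoid.Properties using () renaming (Unique-resp-↭ to Unique-resp-↭ₛ)
open import Data.Product using (Σ; ∃; ∃₂; _×_; _,_; proj₁; proj₂)
open import Data.Sum using (_⊎_; inj₁; inj₂)
open import Function using (_∘_)
open import Function.Bundles using (_⇔_; mk⇔; Equivalence)
open import Relation.Nullary using (yes; no; contradiction)
open import Relation.Nullary.Decidable using (_×-dec_; ¬?; decidable-stable)
open import Relation.Binary.PropositionalEquality
  using (_≡_; _≢_; refl; sym; trans; cong; cong₂; subst; subst₂; setoid; ≢-sym)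

-- Counting in duplicate-free lists.

indicator≤1 : (b : Bool) → (if b then 1 else 0) ≤ 1
indicator≤1 true  = s≤s z≤n
indicator≤1 false = z≤n

module _ {A : Set} where

  Unique-resp-↭ : {xs ys : List A} → xs ↭ ys → Unique xs → Unique ys
  Unique-resp-↭ p = Unique-resp-↭ₛ (setoid A) (↭⇒↭ₛ p)

  Unique-++⁻ˡ : (xs {ys} : List A) → Unique (xs ++ ys) → Unique xs
  Unique-++⁻ˡ []       u        = []
  Unique-++⁻ˡ (x ∷ xs) (x∉ ∷ u) = All.++⁻ˡ xs x∉ ∷ Unique-++⁻ˡ xs u

  count : (A → Bool) → List A → ℕ
  count f xs = sum (map (λ x → if f x then 1 else 0) xs)

  count-++ : ∀ f xs ys → count f (xs ++ ys) ≡ count f xs + count f ys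
  count-++ f xs ys = trans (cong sum (map-++ _ xs ys)) (sum-++ (map _ xs) (map _ ys))

  count-resp-↭ : ∀ f {xs ys} → xs ↭ ys → count f xs ≡ count f ys
  count-resp-↭ f p = sum-↭ (↭-map⁺ _ p)

  count≤length : ∀ f xs → count f xs ≤ length xs
  count≤length f []       = z≤n
  count≤length f (x ∷ xs) with f x
  ... | true  = s≤s (count≤length f xs)
  ... | false = m≤n⇒m≤1+n (count≤length f xs)

  count-const-true : (xs : List A) → count (λ _ → true) xs ≡ length xs
  count-const-true []       = refl
  count-const-true (x ∷ xs) = cong suc (count-const-true xs)

  count-none : ∀ f {xs} → All (λ x → f x ≡ false) xs → count f xs ≡ 0
  count-none f []       = refl
  count-none f (e ∷ es) rewrite e = count-none f es

  count-positive : ∀ f xs → 1 ≤ count f xs → ∃ λ x → x ∈ xs × f x ≡ true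
  count-positive f (x ∷ xs) h with f x in e
  ... | true  = x , here refl , e
  ... | false with y , y∈ , fy ← count-positive f xs h = y , there y∈ , fy

  ∈⇒↭∷ : ∀ {x : A} {xs} → x ∈ xs → ∃ λ ys → xs ↭ x ∷ ys
  ∈⇒↭∷ {x} x∈ with as , bs , refl ← ∈-∃++ x∈ = as ++ bs , shift x as bs

  count-mono-⊆ : ∀ f {xs ys} → Unique xs → (∀ {x} → x ∈ xs → f x ≡ true → x ∈ ys) →
                 count f xs ≤ count f ys
  count-mono-⊆ f {[]}     u        sub = z≤n
  count-mono-⊆ f {x ∷ xs} (x∉ ∷ u) sub with f x in fx
  ... | false = count-mono-⊆ f u (sub ∘ there)
  ... | true with ys′ , p ← ∈⇒↭∷ (sub (here refl) fx)
    rewrite count-resp-↭ f p | fx = s≤s (count-mono-⊆ f u (λ y∈ fy → tail y∈ (∈-resp-↭ p (sub (there y∈) fy))))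
    where
    tail : ∀ {y} → y ∈ xs → y ∈ x ∷ ys′ → y ∈ ys′
    tail y∈ (here refl) = contradiction refl (All.lookup x∉ y∈)
    tail y∈ (there y∈′) = y∈′

  length-mono-⊆ : ∀ {xs ys : List A} → Unique xs → (∀ {x} → x ∈ xs → x ∈ ys) → length xs ≤ length ys
  length-mono-⊆ {xs} {ys} u sub
    rewrite sym (count-const-true xs) | sym (count-const-true ys) = count-mono-⊆ _ u (λ x∈ _ → sub x∈)

count-map : ∀ {A B : Set} (f : B → Bool) (g : A → B) xs → count f (map g xs) ≡ count (f ∘ g) xs
count-map f g xs = cong sum (sym (map-∘ xs))

lookup-injective : ∀ {A : Set} {xs : List A} → Unique xs → ∀ {i j} → lookup xs i ≡ lookup xs j → i ≡ j
lookup-injective (_  ∷ _) {fzero}  {fzero}  e = refl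
lookup-injective (x∉ ∷ _) {fzero}  {fsuc j} e = contradiction e (All.lookup x∉ (∈-lookup j))
lookup-injective (x∉ ∷ _) {fsuc i} {fzero}  e = contradiction (sym e) (All.lookup x∉ (∈-lookup i))
lookup-injective (_  ∷ u) {fsuc i} {fsuc j} e = cong fsuc (lookup-injective u e)

-- Walks as lists, and cutting them at chosen vertices.

-- The list records the vertices of the walk after its start, so that concatenation of walks is
-- concatenation of lists and a closed walk lists each of its vertices once.
data Path {V : Set} (R : V → V → Set) : V → List V → V → Set where
  []  : ∀ {u} → Path R u [] u
  _∷_ : ∀ {u x xs v} → R u x → Path R x xs v → Path R u (x ∷ xs) v

module _ {V : Set} {R : V → V → Set} where

  infixr 5 _◅◅_
  _◅◅_ : ∀ {u xs v ys w} → Path R u xs v → Path R v ys w → Path R u (xs ++ ys) w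
  []       ◅◅ q = q
  (r ∷ p) ◅◅ q = r ∷ (p ◅◅ q)

  split : ∀ {u xs v y} → Path R u xs v → y ∈ xs →
          ∃₂ λ as bs → xs ≡ as ++ bs × Path R u as y × Path R y bs v × y ∈ as
  split (r ∷ p) (here refl) = _ , _ , refl , r ∷ [] , p , here refl
  split (r ∷ p) (there y∈) with as , bs , refl , p₁ , p₂ , y∈as ← split p y∈ =
    _ , _ , refl , r ∷ p₁ , p₂ , there y∈as

  target∈ : ∀ {u x xs v} → Path R u (x ∷ xs) v → v ∈ x ∷ xs
  target∈ (r ∷ [])      = here refl
  target∈ (r ∷ (s ∷ p)) = there (target∈ (s ∷ p))

  distinct-steps : ∀ {u xs v} → Path R u xs v → Unique (u ∷ xs) → Path (λ x y → R x y × x ≢ y) u xs v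
  distinct-steps []      _                = []
  distinct-steps (r ∷ p) ((u≢x ∷ _) ∷ un) = (r , u≢x) ∷ distinct-steps p un

  -- The start of a closed walk is also its last entry, so uniqueness separates it from the first
  -- entry once there are two. This rules out loops, which the digraph below has at every vertex.
  distinct-steps-closed : ∀ {u xs} → Path R u xs u → Unique xs → 2 ≤ length xs → Path (λ x y → R x y × x ≢ y) u xs u
  distinct-steps-closed (r ∷ [])      _           (s≤s ())
  distinct-steps-closed (r ∷ (s ∷ p)) (x∉ ∷ un) _ =
    (r , ≢-sym (All.lookup x∉ (target∈ (s ∷ p)))) ∷ distinct-steps (s ∷ p) (x∉ ∷ un)

  lookup-step : ∀ {y ys v} → Path R y ys v → (i j : Fin (suc (length ys))) → toℕ j ≡ suc (toℕ i) →
                R (lookup (y ∷ ys) i) (lookup (y ∷ ys) j)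
  lookup-step (r ∷ p) fzero    (fsuc fzero) e = r
  lookup-step (r ∷ p) (fsuc i) (fsuc j)     e = lookup-step p i j (suc-injective e)

  lookup-last : ∀ {y ys v} → Path R y ys v → (i : Fin (suc (length ys))) → toℕ i ≡ length ys → lookup (y ∷ ys) i ≡ v
  lookup-last []      fzero    e = refl
  lookup-last (r ∷ p) (fsuc i) e = lookup-last p i (suc-injective e)

  lookup-cyclic : ∀ {u y ys} → R u y → Path R y ys u → (i j : Fin (suc (length ys))) →
                  toℕ j ≡ suc (toℕ i) % suc (length ys) → R (lookup (y ∷ ys) i) (lookup (y ∷ ys) j)
  lookup-cyclic {y = y} {ys} r p i j e with toℕ i <? length ys
  ... | yes h = lookup-step p i j (trans e (m<n⇒m%n≡m (s≤s h)))
  -- At the last index the walk has returned to `u`, whose step `r` leads to the first entry.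
  ... | no h = subst₂ (λ a b → R a (lookup (y ∷ ys) b)) (sym (lookup-last p i i≡last)) (sym j≡0) r
    where
    i≡last : toℕ i ≡ length ys
    i≡last = ≤-antisym (s≤s⁻¹ (toℕ<n i)) (≮⇒≥ h)
    j≡0 : j ≡ fzero
    j≡0 = toℕ-injective (trans e (trans (cong (λ n → suc n % suc (length ys)) i≡last) (n%n≡0 (suc (length ys)))))

  -- Only vertices failing `f` are cut off, so all hits lie in `z ∷ bs`. A step from `v` back to `z`
  -- then closes a cycle through all of them.
  from-first-hit : ∀ f {u xs v} → Path R u xs v → f v ≡ true →
          ∃ λ z → ∃₂ λ as bs → u ∷ xs ≡ as ++ z ∷ bs × Path R z bs v × f z ≡ true × count f (u ∷ xs) ≤ suc (length bs)
  from-first-hit f {u} {xs} p fv with f u in fu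
  from-first-hit f {xs = xs} p fv | true = _ , [] , _ , refl , p , fu , s≤s (count≤length f xs)
  from-first-hit f [] fv | false with () ← trans (sym fv) fu
  from-first-hit f {u} (r ∷ p) fv | false
    with z , as , bs , e , q , fz , h ← from-first-hit f p fv = z , u ∷ as , bs , cong (u ∷_) e , q , fz , h

  to-last-hit : ∀ f {u xs v} → Path R u xs v → 1 ≤ count f (u ∷ xs) →
         ∃ λ z → ∃₂ λ as bs → xs ≡ as ++ bs × Path R u as z × f z ≡ true × count f (u ∷ xs) ≤ suc (length as)
  to-last-hit f {u} [] h with f u in fu
  ... | true = u , [] , [] , refl , [] , fu , s≤s z≤n
  to-last-hit f {u} (_∷_ {x = x} {xs} r p) h with count f (x ∷ xs) in e
  to-last-hit f {u} (r ∷ p) h | suc n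
    with z , as , bs , refl , q , fz , h′ ← to-last-hit f p (subst (1 ≤_) (sym e) (s≤s z≤n)) =
      z , _ , bs , refl , r ∷ q , fz , +-mono-≤ (indicator≤1 (f u)) (subst (_≤ suc (length as)) e h′)
  to-last-hit f {u} (r ∷ p) h | zero with f u in fu
  ... | true = u , [] , _ , refl , [] , fu , s≤s z≤n

-- Gaps between two vertex sets on a cycle.

module _ {V : Set} {R : V → V → Set} (S T : V → Bool) where

  open CommutativeMonoidSolver (++-commutativeMonoid {A = V}) using (solve; _⊕_; _⊜_)

  Quiet : V → Set
  Quiet z = S z ≡ false × T z ≡ false

  -- A cyclic arrangement of X as a segment from x ∈ S to y ∈ T with interior bs, and the way back.
  record Gap (X : List V) : Set where
    constructor gap
    field
      {x y}  : V
      {as}   : List V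
      bs     : List V
      x∈S    : S x ≡ true
      y∈T    : T y ≡ true
      back   : Path R y as x
      across : Path R x (bs ++ [ y ]) y
      cyclic : X ↭ as ++ bs ++ [ y ]

  QuietGap : List V → Set
  QuietGap X = Σ (Gap X) λ g → All Quiet (Gap.bs g)

  QuietGap-resp-↭ : ∀ {X Y} → X ↭ Y → QuietGap Y → QuietGap X
  QuietGap-resp-↭ e (gap bs Sx Ty p q c , quiet) = gap bs Sx Ty p q (↭-trans e c) , quiet

  -- Scan from `x` towards `y`, with `us` the quiet vertices passed so far and `z` the next one. A
  -- `z` in `T` ends the gap, a `z` in `S` only restarts it, and any other `z` joins `us`. The scan
  -- succeeds because `y` is in `T`.
  quiet-gap : ∀ {x y as us v z bs} → S x ≡ true → T y ≡ true → Path R y as x → Path R x us v → All Quiet us →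
              R v z → Path R z bs y → QuietGap (as ++ us ++ z ∷ bs)
  quiet-gap {us = us} Sx Ty back p quiet r [] = gap us Sx Ty back (p ◅◅ r ∷ []) ↭-refl , quiet
  quiet-gap {as = as} {us} {z = z} {z′ ∷ bs} Sx Ty back p quiet r (s ∷ q) with T z in Tz | S z in Sz
  ... | true  | _ = gap us Sx Tz ((s ∷ q) ◅◅ back) (p ◅◅ r ∷ [])
        (solve 4 (λ a u c b → a ⊕ (u ⊕ (c ⊕ b)) ⊜ (b ⊕ a) ⊕ (u ⊕ c)) ↭-refl as us [ z ] (z′ ∷ bs)) , quiet
  ... | false | true = QuietGap-resp-↭
        (solve 4 (λ a u c b → a ⊕ (u ⊕ (c ⊕ b)) ⊜ (a ⊕ (u ⊕ c)) ⊕ b) ↭-refl as us [ z ] (z′ ∷ bs))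
        (quiet-gap Sz Ty (back ◅◅ p ◅◅ r ∷ []) [] [] s q)
  ... | false | false = QuietGap-resp-↭
        (solve 4 (λ a u c b → a ⊕ (u ⊕ (c ⊕ b)) ⊜ a ⊕ ((u ⊕ c) ⊕ b)) ↭-refl as us [ z ] (z′ ∷ bs))
        (quiet-gap Sx Ty back (p ◅◅ r ∷ []) (All.++⁺ quiet ((Sz , Tz) ∷ [])) s q)

  cycle-quiet-gap : ∀ {u X} → Path R u X u → 1 ≤ count S X → 1 ≤ count T X → QuietGap X
  cycle-quiet-gap p hS hT
    with s , s∈ , Ss ← count-positive S _ hS
    with as , bs , refl , p₁ , p₂ , s∈as ← split p s∈
    with t , t∈ , Tt ← count-positive T _ hT
    -- The rotated list ends at `s`, so a `t` equal to `s` is reached after a full turn, and the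
    -- segment from `s` to `t` has at least one step.
    with cs , ds , e , q₁ , q₂ , t∈cs ← split (p₂ ◅◅ p₁) (∈-resp-↭ (solve 2 (λ a b → a ⊕ b ⊜ b ⊕ a) ↭-refl as bs) t∈)
    with q₁
  ... | r ∷ q = QuietGap-resp-↭
        (↭-trans (solve 2 (λ a b → a ⊕ b ⊜ b ⊕ a) ↭-refl as bs)
          (↭-trans (↭-reflexive e) (solve 2 (λ a b → a ⊕ b ⊜ b ⊕ a) ↭-refl cs ds)))
        (quiet-gap Ss Tt q₂ [] [] r q)

  χ : (V → Bool) → V → ℕ
  χ f x = if f x then 1 else 0

  -- Without a step from `S` to `T`, each step has its source in `S` or its target in `T`, but not
  -- both. Summing over the steps counts `S` on the sources; `χ S u` and `χ S v` correct for the two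
  -- ends.
  tight-or-sparse : ∀ {u xs v} → Path R u xs v →
    (∃₂ λ x y → ∃₂ λ as bs → xs ≡ as ++ y ∷ bs × Path R u as x × R x y × Path R y bs v × S x ≡ true × T y ≡ true)
    ⊎ χ S u + (count S xs + count T xs) ≤ length xs + χ S v
  tight-or-sparse {u} [] = inj₂ (≤-reflexive (+-identityʳ _))
  tight-or-sparse {u} {v = v} (_∷_ {x = x} {xs} r p) with tight-or-sparse p
  ... | inj₁ (y , z , as , bs , refl , p₁ , s , p₂ , Sy , Tz) = inj₁ (y , z , x ∷ as , bs , refl , r ∷ p₁ , s , p₂ , Sy , Tz)
  ... | inj₂ h with S u in Su | T x in Tx
  ...   | true  | true  = inj₁ (u , x , [] , xs , refl , [] , r , p , Su , Tx)
  ...   | true  | false = inj₂ (s≤s (subst (_≤ length xs + χ S v) (sym (+-assoc (χ S x) (count S xs) (count T xs))) h))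
  ...   | false | true  = inj₂ (subst (_≤ suc (length xs + χ S v)) (eq (χ S x) (count S xs) (count T xs)) (s≤s h))
    where
    eq : ∀ a b c → suc (a + (b + c)) ≡ a + b + suc c
    eq = solve-∀
  ...   | false | false = inj₂ (m≤n⇒m≤1+n (subst (_≤ length xs + χ S v) (sym (+-assoc (χ S x) (count S xs) (count T xs))) h))

  -- A quiet gap longer than `l` supplies more than `l` vertices in neither set, and
  -- `tight-or-sparse` bounds the counts on its way back. A tight step there is itself a gap with
  -- empty interior.
  narrow-gap-or-sparse : ∀ {u X} → Path R u X u → 1 ≤ count S X → 1 ≤ count T X → ∀ l →
    (Σ (Gap X) λ g → length (Gap.bs g) ≤ l) ⊎ count S X + count T X + l ≤ length X
  narrow-gap-or-sparse {X = X} p hS hT l with cycle-quiet-gap p hS hT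
  ... | g@(gap {x} {y} {as} us Sx Ty back across cyclic) , quiet with length us ≤? l
  ...   | yes h = inj₁ (g , h)
  ...   | no h with tight-or-sparse back
  ...     | inj₁ (v , w , cs , ds , refl , p₁ , r , p₂ , Sv , Tw) =
            inj₁ (gap [] Sv Tw (p₂ ◅◅ across ◅◅ p₁) (r ∷ []) (↭-trans cyclic
              (solve 5 (λ c w d u y → (c ⊕ (w ⊕ d)) ⊕ (u ⊕ y) ⊜ (d ⊕ ((u ⊕ y) ⊕ c)) ⊕ w) ↭-refl cs [ w ] ds us [ y ])) , z≤n)
  ...     | inj₂ sparse = inj₂ (begin
      count S X + count T X + l
        ≡⟨ cong₂ (λ a b → a + b + l) (count-split S (All.map proj₁ quiet)) (count-split T (All.map proj₂ quiet)) ⟩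
      count S as + χ S y + (count T as + χ T y) + l
        ≡⟨ cong (λ b → count S as + χ S y + (count T as + (if b then 1 else 0)) + l) Ty ⟩
      count S as + χ S y + (count T as + 1) + l
        ≡⟨ rearrange (count S as) (χ S y) (count T as) l ⟩
      χ S y + (count S as + count T as) + suc l
        ≤⟨ +-mono-≤ sparse (≰⇒> h) ⟩
      length as + χ S x + length us
        ≡⟨ cong (λ b → length as + (if b then 1 else 0) + length us) Sx ⟩
      length as + 1 + length us
        ≡⟨ trans (+-assoc (length as) 1 _) (cong (length as +_) (+-comm 1 (length us))) ⟩
      length as + (length us + 1)
        ≡⟨ trans (length-++ as) (cong (length as +_) (length-++ us)) ⟨
      length (as ++ us ++ [ y ])
        ≡⟨ ↭-length cyclic ⟨
      length X ∎)
    where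
    open ≤-Reasoning
    rearrange : ∀ a b c l → a + b + (c + 1) + l ≡ b + (a + c) + suc l
    rearrange = solve-∀
    count-split : ∀ f → All (λ z → f z ≡ false) us → count f X ≡ count f as + χ f y
    count-split f none = trans (count-resp-↭ f cyclic) (trans (count-++ f as _) (cong (count f as +_)
      (trans (count-++ f us [ y ]) (cong₂ _+_ (count-none f none) (+-identityʳ _)))))

-- The digraph on a colour class.

≢∧≢⇒≡ : ∀ {a b d : Bool} → a ≢ b → d ≢ b → a ≡ d
≢∧≢⇒≡ a≢b d≢b = trans (Bool.¬-not a≢b) (sym (Bool.¬-not d≢b))

module Digraph {ν : ℕ} (G : Graph ν) (c : Fin ν → Bool) (bipartite : IsBipartition G c)
  (m : Fin ν → Fin ν) (m-involutive : ∀ x → m (m x) ≡ x) (m-adjacent : ∀ x → Adj G x (m x)) where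

  open Graph G using (E) renaming (sym to E-sym)
  open import Data.List.Membership.DecPropositional (_≟_ {ν}) using (_∈?_)
  open CommutativeMonoidSolver (++-commutativeMonoid {A = Fin ν}) using (solve; _⊕_; _⊜_)

  A : Fin ν → Set
  A x = c x ≡ true

  -- Loops are kept: `m-adjacent x` is `R x x`. Counting them, the out-degree of `x` is `deg G x`
  -- and its in-degree is `deg G (m x)`.
  R : Fin ν → Fin ν → Set
  R x y = E x (m y) ≡ true

  partner-colour : ∀ x → c x ≢ c (m x)
  partner-colour x = bipartite x (m x) (m-adjacent x)

  A-head : ∀ {x y} → A x → R x y → A y
  A-head {x} {y} Ax r = trans (≢∧≢⇒≡ (partner-colour y) (bipartite x (m y) r)) Ax

  A-tail : ∀ {x y} → A y → R x y → A x
  A-tail {x} {y} Ay r = trans (≢∧≢⇒≡ (bipartite x (m y) r) (partner-colour y)) Ay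

  -- A directed step to `x` becomes two edges of the graph, first to the partner `m x`, then along
  -- the matching edge to `x`.
  expand : List (Fin ν) → List (Fin ν)
  expand []       = []
  expand (x ∷ xs) = m x ∷ x ∷ expand xs

  length-expand : ∀ xs → length (expand xs) ≡ 2 * length xs
  length-expand []       = refl
  length-expand (x ∷ xs) = trans (cong (suc ∘ suc) (length-expand xs)) (sym (*-suc 2 (length xs)))

  ∈-expand⁺ : ∀ {y xs} → y ∈ xs → y ∈ expand xs × m y ∈ expand xs
  ∈-expand⁺ (here refl) = there (here refl) , here refl
  ∈-expand⁺ (there y∈) with h , h′ ← ∈-expand⁺ y∈ = there (there h) , there (there h′)

  ∈-expand⁻ : ∀ {y} xs → y ∈ expand xs → y ∈ xs ⊎ m y ∈ xs
  ∈-expand⁻ (x ∷ xs) (here refl)         = inj₂ (here (m-involutive x))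
  ∈-expand⁻ (x ∷ xs) (there (here refl)) = inj₁ (here refl)
  ∈-expand⁻ (x ∷ xs) (there (there y∈)) with ∈-expand⁻ xs y∈
  ... | inj₁ h = inj₁ (there h)
  ... | inj₂ h = inj₂ (there h)

  partner∉ : ∀ {x xs} → A x → All A xs → m x ∉ xs
  partner∉ {x} Ax Axs h = partner-colour x (trans Ax (sym (All.lookup Axs h)))

  expand-unique : ∀ {xs} → Unique xs → All A xs → Unique (expand xs)
  expand-unique [] [] = []
  expand-unique {x ∷ xs} (x∉ ∷ u) (Ax ∷ Axs) =
    ((λ e → partner-colour x (cong c (sym e))) ∷ All.tabulate partner-new) ∷ All.tabulate new ∷ expand-unique u Axs
    where
    new : ∀ {y} → y ∈ expand xs → x ≢ y
    new y∈ refl with ∈-expand⁻ xs y∈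
    ... | inj₁ h = contradiction refl (All.lookup x∉ h)
    ... | inj₂ h = partner∉ Ax Axs h
    partner-new : ∀ {y} → y ∈ expand xs → m x ≢ y
    partner-new y∈ refl with ∈-expand⁻ xs y∈
    ... | inj₁ h = partner∉ Ax Axs h
    ... | inj₂ h = contradiction refl (All.lookup x∉ (subst (_∈ xs) (m-involutive x) h))

  length-unique≤ν : ∀ {xs : List (Fin ν)} → Unique xs → length xs ≤ ν
  length-unique≤ν {xs} u = subst (length xs ≤_) (length-tabulate (λ i → i)) (length-mono-⊆ u (λ {x} _ → ∈-allFin x))

  out-degree-bound : ∀ x {L} → (∀ y → R x y → y ∈ L) → deg G x ≤ count (λ y → E x (m y)) L
  out-degree-bound x {L} h = subst (deg G x ≤_) (count-map (E x) m L)
    (count-mono-⊆ (E x) (allFin⁺ ν) (λ {z} _ e → subst (_∈ map m L) (m-involutive z)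
      (∈-map⁺ m (h (m z) (subst (λ w → E x w ≡ true) (sym (m-involutive z)) e)))))

  in-degree-bound : ∀ x {L} → (∀ y → R y x → y ∈ L) → deg G (m x) ≤ count (E (m x)) L
  in-degree-bound x h = count-mono-⊆ (E (m x)) (allFin⁺ ν) (λ {z} _ e → h z (trans (E-sym z (m x)) e))

  -- Maximal means that neither end extends to a new vertex off `X`, which is empty for the initial
  -- cycle and later lists the vertices of the current cycle.
  record MaximalPath (X : List (Fin ν)) : Set where
    field
      {p q}      : Fin ν
      {ps}       : List (Fin ν)
      path       : Path R p ps q
      unique     : Unique ((p ∷ ps) ++ X)
      coloured   : All A (p ∷ ps)
      out-closed : ∀ y → R q y → y ∈ (p ∷ ps) ++ X
      in-closed  : ∀ y → R y p → y ∈ (p ∷ ps) ++ X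

  source∈A : ∀ {p ps} → All A (p ∷ ps) → A p
  source∈A (Ap ∷ _) = Ap

  target∈A : ∀ {p ps q} → Path R p ps q → All A (p ∷ ps) → A q
  target∈A []          (Ap ∷ _)   = Ap
  target∈A (r ∷ path) (_ ∷ Aps) = target∈A path Aps

  extend : ∀ fuel {X p ps q} → ν ≤ fuel + length ps → Path R p ps q → Unique ((p ∷ ps) ++ X) → All A (p ∷ ps) →
           MaximalPath X
  extend zero {p = p} {ps} h path u col =
    contradiction (≤-trans (length-unique≤ν (Unique-++⁻ˡ (p ∷ ps) u)) h) (<-irrefl refl)
  extend (suc fuel) {X} {p} {ps} {q} h path u col
    with any? (λ y → (E q (m y) Bool.≟ true) ×-dec ¬? (y ∈? ((p ∷ ps) ++ X)))
       | any? (λ y → (E y (m p) Bool.≟ true) ×-dec ¬? (y ∈? ((p ∷ ps) ++ X)))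
  ... | yes (y , r , y∉) | _ =
    extend fuel (≤-trans h (≤-reflexive (trans (sym (+-suc fuel _)) (cong (fuel +_) (sym (trans (length-++ ps) (+-comm _ 1)))))))
      (path ◅◅ r ∷ [])
      (Unique-resp-↭ (solve 4 (λ y p ps X → y ⊕ ((p ⊕ ps) ⊕ X) ⊜ (p ⊕ (ps ⊕ y)) ⊕ X) ↭-refl [ y ] [ p ] ps X)
        (All.¬Any⇒All¬ _ y∉ ∷ u))
      (All.++⁺ col (A-head (target∈A path col) r ∷ []))
  ... | no _ | yes (y , r , y∉) =
    extend fuel (≤-trans h (≤-reflexive (sym (+-suc fuel _)))) (r ∷ path) (All.¬Any⇒All¬ _ y∉ ∷ u)
      (A-tail (source∈A col) r ∷ col)
  ... | no out | no inn = record
    { path = path ; unique = u ; coloured = col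
    ; out-closed = λ y r → decidable-stable (y ∈? _) (λ y∉ → out (y , r , y∉))
    ; in-closed  = λ y r → decidable-stable (y ∈? _) (λ y∉ → inn (y , r , y∉)) }

  maximal-path : ∀ {X v} → A v → Unique X → v ∉ X → MaximalPath X
  maximal-path Av u v∉ = extend ν (m≤m+n ν _) [] (All.¬Any⇒All¬ _ v∉ ∷ u) (Av ∷ [])

  record Cycle : Set where
    constructor cycle
    field
      {base}     : Fin ν
      {vertices} : List (Fin ν)
      closed     : Path R base vertices base
      unique     : Unique vertices
      coloured   : All A vertices
    size : ℕ
    size = length vertices
  open Cycle using (vertices; size)

  -- Too long for a path outside C to contain all in-neighbours of its source or all
  -- out-neighbours of its target.
  Long : Cycle → Set
  Long C = (∃ λ q → A q × deg G q ≤ size C) × (∃ λ p → A p × deg G (m p) ≤ size C)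

  longer-stays-long : ∀ {C D} → size C ≤ size D → Long C → Long D
  longer-stays-long h ((q , Aq , hq) , (p , Ap , hp)) = (q , Aq , ≤-trans hq h) , (p , Ap , ≤-trans hp h)

  -- Closing from `q` to its first out-neighbour on the path catches all out-neighbours of `q`;
  -- closing from the last in-neighbour of `p` to `p` catches all in-neighbours of `p`. The longer
  -- of the two cycles meets both bounds.
  initial-cycle : ∀ {v} → A v → Σ Cycle Long
  initial-cycle Av with maximal-path Av [] (λ ())
  ... | record { p = p ; q = q ; ps = ps ; path = path ; unique = u ; coloured = col ; out-closed = oc ; in-closed = ic }
    -- The loops at `q` and `p` ensure that both searches succeed.
    with from-first-hit (λ y → E q (m y)) path (m-adjacent q)
       | to-last-hit (E (m p)) path (≤-trans (≤-reflexive (cong (if_then 1 else 0) (sym (trans (E-sym (m p) p) (m-adjacent p))))) (m≤m+n _ _))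
  ... | z , as , bs , e , zq , r , h | w , cs , ds , e′ , pw , r′ , h′ =
    choose (≤-total (size C) (size D))
    where
    C D : Cycle
    C = cycle (zq ◅◅ r ∷ [])
      (Unique-++⁻ˡ (bs ++ [ z ]) (Unique-resp-↭ (↭-trans (↭-reflexive (trans (++-identityʳ (p ∷ ps)) e)) rotate) u))
      (All.++⁻ˡ (bs ++ [ z ]) (All-resp-↭ (↭-trans (↭-reflexive e) rotate) col))
      where
      rotate : as ++ z ∷ bs ↭ (bs ++ [ z ]) ++ as
      rotate = solve 3 (λ a z b → a ⊕ (z ⊕ b) ⊜ (b ⊕ z) ⊕ a) ↭-refl as [ z ] bs
    D = cycle (pw ◅◅ trans (E-sym w (m p)) r′ ∷ [])
      (Unique-++⁻ˡ (cs ++ [ p ]) (Unique-resp-↭ (↭-trans (↭-reflexive (++-identityʳ (p ∷ ps))) rotate) u))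
      (All.++⁻ˡ (cs ++ [ p ]) (All-resp-↭ rotate col))
      where
      rotate : p ∷ ps ↭ (cs ++ [ p ]) ++ ds
      rotate = ↭-trans (↭-reflexive (cong (p ∷_) e′))
        (solve 3 (λ p c d → p ⊕ (c ⊕ d) ⊜ (c ⊕ p) ⊕ d) ↭-refl [ p ] cs ds)
    no-suffix : ∀ f → count f ((p ∷ ps) ++ []) ≤ count f (p ∷ ps)
    no-suffix f = ≤-reflexive (cong (count f) (++-identityʳ (p ∷ ps)))
    out-end : deg G q ≤ size C
    out-end = ≤-trans (out-degree-bound q oc) (≤-trans (no-suffix _)
      (≤-trans h (≤-reflexive (sym (trans (length-++ bs) (+-comm _ 1))))))
    in-end : deg G (m p) ≤ size D
    in-end = ≤-trans (in-degree-bound p ic) (≤-trans (no-suffix _)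
      (≤-trans h′ (≤-reflexive (sym (trans (length-++ cs) (+-comm _ 1))))))
    Aq : A q
    Aq = target∈A path col
    choose : size C ≤ size D ⊎ size D ≤ size C → Σ Cycle Long
    choose (inj₁ C≤D) = D , (q , Aq , ≤-trans out-end C≤D) , (p , source∈A col , in-end)
    choose (inj₂ D≤C) = C , (q , Aq , out-end) , (p , source∈A col , ≤-trans in-end D≤C)

  -- The new cycle goes `back` from `y` to `x`, then from `p` to `q`, and on to `y`, leaving out
  -- `bs`. The inserted path has `suc (length ps)` vertices, so growth is strict.
  insert-path : ∀ {X p q ps} → Path R p ps q → Unique ((p ∷ ps) ++ X) → All A (p ∷ ps) → All A X →
                (g : Gap {R = R} (E (m p)) (λ y → E q (m y)) X) → length (Gap.bs g) ≤ length ps →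
                Σ Cycle λ D → length X < size D
  insert-path {X} {p} {ps = ps} path u Aps AX (gap {x} {y} {as} bs x→p q→y back across cyclic) short =
    cycle (back ◅◅ trans (E-sym x (m p)) x→p ∷ (path ◅◅ q→y ∷ []))
      (Unique-++⁻ˡ (as ++ p ∷ ps ++ [ y ]) (Unique-resp-↭ exchange u))
      (All.++⁻ˡ (as ++ p ∷ ps ++ [ y ]) (All-resp-↭ exchange (All.++⁺ Aps AX)))
    , longer
    where
    open ≤-Reasoning
    exchange : (p ∷ ps) ++ X ↭ (as ++ p ∷ ps ++ [ y ]) ++ bs
    exchange = ↭-trans (↭-++⁺ˡ (p ∷ ps) cyclic)
      (solve 5 (λ a p ps y b → (p ⊕ ps) ⊕ (a ⊕ (b ⊕ y)) ⊜ (a ⊕ (p ⊕ (ps ⊕ y))) ⊕ b) ↭-refl as [ p ] ps [ y ] bs)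
    longer : length X < length (as ++ p ∷ ps ++ [ y ])
    longer = begin-strict
      length X                          ≡⟨ ↭-length cyclic ⟩
      length (as ++ bs ++ [ y ])        ≡⟨ trans (length-++ as) (cong (length as +_) (length-++ bs)) ⟩
      length as + (length bs + 1)       <⟨ +-monoʳ-< (length as) (s≤s (+-monoˡ-≤ 1 short)) ⟩
      length as + suc (length ps + 1)   ≡⟨ trans (length-++ as) (cong (λ n → length as + suc n) (length-++ ps)) ⟨
      length (as ++ p ∷ ps ++ [ y ])    ∎

  -- Enlarging a cycle under the degree condition.

  module _ (degree-sum : ∀ x y → c x ≢ c y → ν + 4 ≤ 2 * (deg G x + deg G y)) where

    -- The entries of `L` and their partners are all distinct, so `2 * length L` is at most `ν`; and
    -- `x` and `m y` have different colours.
    degree-excess : ∀ {x y L} → A x → A y → Unique L → All A L → 2 + length L ≤ deg G x + deg G (m y)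
    degree-excess {x} {y} {L} Ax Ay u AL = *-cancelˡ-≤ 2 (begin
      2 * (2 + length L)             ≡⟨ trans (*-distribˡ-+ 2 2 (length L)) (+-comm 4 _) ⟩
      2 * length L + 4               ≡⟨ cong (_+ 4) (length-expand L) ⟨
      length (expand L) + 4          ≤⟨ +-monoˡ-≤ 4 (length-unique≤ν (expand-unique u AL)) ⟩
      ν + 4                          ≤⟨ degree-sum x (m y) (λ e → partner-colour y (trans Ay (trans (sym Ax) e))) ⟩
      2 * (deg G x + deg G (m y))    ∎)
      where open ≤-Reasoning

    enlarge : ∀ (C : Cycle) {v} → Long C → A v → v ∉ vertices C → Σ Cycle λ D → size C < size D
    enlarge (cycle {vertices = X} closed u AX) ((q₀ , Aq₀ , hq₀) , (p₀ , Ap₀ , hp₀)) Av v∉ = improved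
      where
      open ≤-Reasoning
      open MaximalPath (maximal-path Av u v∉)
      S T : Fin ν → Bool
      S y = E (m p) y
      T y = E q (m y)
      -- Here `L` is the path together with the cycle, and the extra `suc` counts `p`. Each
      -- contradiction below bounds such a degree sum by `2 + (length ps + length X)`.
      excess : ∀ {x y} → A x → A y → suc (2 + (length ps + length X)) ≤ deg G x + deg G (m y)
      excess Ax Ay = subst (λ n → 2 + suc n ≤ _) (length-++ ps)
        (degree-excess Ax Ay unique (All.++⁺ coloured AX))
      Ap : A p
      Ap = source∈A coloured
      Aq : A q
      Aq = target∈A path coloured
      count-bound : ∀ f → count f ((p ∷ ps) ++ X) ≤ suc (length ps) + count f X
      count-bound f = ≤-trans (≤-reflexive (count-++ f (p ∷ ps) X)) (+-monoˡ-≤ (count f X) (count≤length f (p ∷ ps)))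
      out-bound : deg G q ≤ suc (length ps) + count T X
      out-bound = ≤-trans (out-degree-bound q out-closed) (count-bound T)
      in-bound : deg G (m p) ≤ suc (length ps) + count S X
      in-bound = ≤-trans (in-degree-bound p in-closed) (count-bound S)
      -- If `S` misses the cycle, all in-neighbours of `p` lie on the path, while `Long` provides a
      -- second degree of at most `length X`; the sum is too small.
      S-nonempty : 1 ≤ count S X
      S-nonempty with count S X | in-bound
      ... | suc n | _ = s≤s z≤n
      ... | zero  | h = contradiction (≤-trans (excess Aq₀ Ap) (begin
        deg G q₀ + deg G (m p)              ≤⟨ +-mono-≤ hq₀ h ⟩
        length X + (suc (length ps) + 0)    ≡⟨ rearrange (length X) (length ps) ⟩
        suc (length ps + length X)          ≤⟨ n≤1+n _ ⟩
        2 + (length ps + length X)          ∎)) (<-irrefl refl)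
        where
        rearrange : ∀ a b → a + (suc b + 0) ≡ suc (b + a)
        rearrange = solve-∀
      T-nonempty : 1 ≤ count T X
      T-nonempty with count T X | out-bound
      ... | suc n | _ = s≤s z≤n
      ... | zero  | h = contradiction (≤-trans (excess Aq Ap₀) (begin
        deg G q + deg G (m p₀)              ≤⟨ +-mono-≤ h hp₀ ⟩
        suc (length ps) + 0 + length X      ≡⟨ cong (_+ length X) (+-identityʳ (suc (length ps))) ⟩
        suc (length ps + length X)          ≤⟨ n≤1+n _ ⟩
        2 + (length ps + length X)          ∎)) (<-irrefl refl)
      improved : Σ Cycle λ D → length X < size D
      -- The bound `length ps` is one less than the number of path vertices: the largest gap whose
      -- replacement lengthens the cycle.
      improved with narrow-gap-or-sparse S T closed S-nonempty T-nonempty (length ps)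
      ... | inj₁ (g , short) = insert-path path unique coloured AX g short
      ... | inj₂ sparse = contradiction (≤-trans (excess Aq Ap) (begin
        deg G q + deg G (m p)                                          ≤⟨ +-mono-≤ out-bound in-bound ⟩
        suc (length ps) + count T X + (suc (length ps) + count S X)    ≡⟨ rearrange (length ps) (count T X) (count S X) ⟩
        2 + (length ps + (count S X + count T X + length ps))          ≤⟨ +-monoʳ-≤ (2 + length ps) sparse ⟩
        2 + (length ps + length X)                                     ∎)) (<-irrefl refl)
        where
        rearrange : ∀ l t s → suc l + t + (suc l + s) ≡ 2 + (l + (s + t + l))
        rearrange = solve-∀

    -- Each enlargement uses up one unit of fuel, and no cycle has more than `ν` vertices. `Long`
    -- survives because it only bounds the size from below.
    covering-cycle-from : ∀ fuel (C : Cycle) → ν ≤ fuel + size C → Long C → Σ Cycle λ D → ∀ y → A y → y ∈ vertices D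
    covering-cycle-from fuel C h long with any? (λ y → (c y Bool.≟ true) ×-dec ¬? (y ∈? vertices C))
    ... | no none = C , λ y Ay → decidable-stable (y ∈? _) (λ y∉ → none (y , Ay , y∉))
    ... | yes (v , Av , v∉) with fuel | enlarge C long Av v∉
    ...   | zero     | D , C<D = contradiction (≤-trans (≤-trans C<D (length-unique≤ν (Cycle.unique D))) h) (<-irrefl refl)
    ...   | suc fuel | D , C<D = covering-cycle-from fuel D
              (≤-trans h (≤-trans (≤-reflexive (sym (+-suc fuel _))) (+-monoʳ-≤ fuel C<D)))
              (longer-stays-long {C} {D} (<⇒≤ C<D) long)

    covering-cycle : ∀ {v} → A v → Σ Cycle λ C → ∀ y → A y → y ∈ vertices C
    covering-cycle Av with C , long ← initial-cycle Av = covering-cycle-from ν C (m≤m+n ν _) long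

    -- All neighbours of `v` in the digraph lie on the cycle, so `deg G v` and `deg G (m v)` are at
    -- most `size C`, while their sum is at least `2 + size C`.
    covering-cycle-nontrivial : ∀ {v} → A v → (C : Cycle) → (∀ y → A y → y ∈ vertices C) → 2 ≤ size C
    covering-cycle-nontrivial {v} Av C covers = +-cancelʳ-≤ (size C) 2 (size C)
      (≤-trans (degree-excess Av Av (Cycle.unique C) (Cycle.coloured C)) (+-mono-≤
        (≤-trans (out-degree-bound v (λ y r → covers y (A-head Av r))) (count≤length _ (vertices C)))
        (≤-trans (in-degree-bound v (λ y r → covers y (A-tail Av r))) (count≤length _ (vertices C)))))

  -- From a covering directed cycle to an alternating one.

  base∈A : ∀ C → 2 ≤ size C → A (Cycle.base C)
  base∈A (cycle (r ∷ closed) _ coloured) _ = target∈A closed coloured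

  length-expand-covering : ∀ (C : Cycle) → (∀ y → A y → y ∈ vertices C) → length (expand (vertices C)) ≡ ν
  length-expand-covering C covers = ≤-antisym
    (length-unique≤ν (expand-unique (Cycle.unique C) (Cycle.coloured C)))
    (subst (_≤ length (expand (vertices C))) (length-tabulate (λ i → i)) (length-mono-⊆ (allFin⁺ ν) (λ {x} _ → member x)))
    where
    member : ∀ x → x ∈ expand (vertices C)
    member x with c x in cx
    ... | true  = proj₁ (∈-expand⁺ (covers x cx))
    ... | false = subst (_∈ _) (m-involutive x) (proj₂ (∈-expand⁺
          (covers (m x) (trans (Bool.¬-not (≢-sym (partner-colour x))) (cong not cx)))))

  module _ (M : Fin ν → Fin ν → Bool) (M-partner : ∀ x → M x (m x) ≡ true) (M-unique : ∀ {x y} → M x y ≡ true → y ≡ m x) where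

    -- Fixing by colour which edges belong to `M` turns alternation into a condition on single
    -- steps, which `Path` can carry.
    Alternating : Fin ν → Fin ν → Set
    Alternating x y = Adj G x y × (M x y ≡ true ⇔ c x ≡ false)

    -- The edge from `u` to `m x` is outside `M`: otherwise `m x` is `m u`, and `u` is `x` because
    -- `m` is an involution. Hence the exclusion of loops.
    expand-path : ∀ {u xs v} → Path (λ x y → R x y × x ≢ y) u xs v → A u → Path Alternating u (expand xs) v
    expand-path [] Au = []
    expand-path {u} (_∷_ {x = x} (r , u≢x) p) Au = out ∷ matched ∷ expand-path p (A-head Au r)
      where
      out : Alternating u (m x)
      out = r , mk⇔
        (λ e → contradiction (trans (sym (m-involutive u)) (trans (cong m (sym (M-unique e))) (m-involutive x))) u≢x)
        (λ e → contradiction (trans (sym Au) e) (λ ()))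
      mx-matched : M (m x) x ≡ true
      mx-matched = subst (λ z → M (m x) z ≡ true) (m-involutive x) (M-partner (m x))
      matched : Alternating (m x) x
      matched = trans (E-sym (m x) x) (m-adjacent x) , mk⇔
        (λ _ → trans (Bool.¬-not (≢-sym (partner-colour x))) (cong not (A-head Au r)))
        (λ _ → mx-matched)

    spanning-alternating-cycle : (∀ x y → c x ≢ c y → ν + 4 ≤ 2 * (deg G x + deg G y)) → ∀ {v} → A v →
      3 ≤ ν × (∃₂ λ u xs → Path Alternating u xs u × Unique xs × length xs ≡ ν)
    spanning-alternating-cycle degree-sum Av = expanded (covering-cycle degree-sum Av)
      where
      expanded : (Σ Cycle λ C → ∀ y → A y → y ∈ vertices C) →
        3 ≤ ν × (∃₂ λ u xs → Path Alternating u xs u × Unique xs × length xs ≡ ν)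
      expanded (C , covers) =
        ≤-trans (n≤1+n 3) (≤-trans (*-monoʳ-≤ 2 nontrivial) (≤-reflexive (trans (sym (length-expand (vertices C))) spanning))) ,
        Cycle.base C , expand (vertices C) ,
        expand-path (distinct-steps-closed (Cycle.closed C) (Cycle.unique C) nontrivial) (base∈A C nontrivial) ,
        expand-unique (Cycle.unique C) (Cycle.coloured C) , spanning
        where
        nontrivial : 2 ≤ size C
        nontrivial = covering-cycle-nontrivial degree-sum Av C covers
        spanning : length (expand (vertices C)) ≡ ν
        spanning = length-expand-covering C covers

-- Indexing the cycle, and the conclusion.

alternating-hamilton-cycle : ∀ {k} (G : Graph (suc k)) (c : Fin (suc k) → Bool) (M : Fin (suc k) → Fin (suc k) → Bool) →
  IsBipartition G c →
  3 ≤ suc k × (∃₂ λ u xs → Path (λ x y → Adj G x y × (M x y ≡ true ⇔ c x ≡ false)) u xs u × Unique xs × length xs ≡ suc k) →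
  AltHamCycle G M
alternating-hamilton-cycle {k} G c M bipartite (h , u , x ∷ xs , r ∷ p , un , len) = record
  { σ         = σ
  ; σ-inj     = λ {i} {j} e → toℕ-injective (trans (sym (toℕ-cast (sym len) i))
                  (trans (cong toℕ (lookup-injective un {index i} {index j} e)) (toℕ-cast (sym len) j)))
  ; length≥3  = h
  ; edges     = λ i → proj₁ (consecutive i)
  -- Consecutive edges start at vertices of opposite colours, so exactly one of them is in `M`.
  ; alternate = λ i → mk⇔
      (λ e e′ → bipartite _ _ (proj₁ (consecutive i)) (trans (to (proj₂ (consecutive i)) e) (sym (to (proj₂ (consecutive (next i))) e′))))
      (λ ne → from (proj₂ (consecutive i)) (≢∧≢⇒≡ (bipartite _ _ (proj₁ (consecutive i)))
        (λ e → ne (from (proj₂ (consecutive (next i))) (sym e)))))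
  }
  where
  open Equivalence using (to; from)
  index : Fin (suc k) → Fin (suc (length xs))
  index = cast (sym len)
  σ : Fin (suc k) → Fin (suc k)
  σ i = lookup (x ∷ xs) (index i)
  index-next : ∀ i → toℕ (index (next i)) ≡ suc (toℕ (index i)) % suc (length xs)
  index-next i = trans (toℕ-cast (sym len) (next i)) (trans (toℕ-fromℕ< (m%n<n (suc (toℕ i)) (suc k)))
    (trans (cong (λ n → suc (toℕ i) % suc n) (sym (suc-injective len)))
      (cong (λ n → suc n % suc (length xs)) (sym (toℕ-cast (sym len) i)))))
  consecutive : ∀ i → Adj G (σ i) (σ (next i)) × (M (σ i) (σ (next i)) ≡ true ⇔ c (σ i) ≡ false)
  consecutive i = lookup-cyclic r p (index i) (index (next i)) (index-next i)

theorem2p1 : (k : ℕ) (G : Graph (suc k)) (c : Fin (suc k) → Bool) (M : Fin (suc k) → Fin (suc k) → Bool)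
    → Connected G → IsBipartition G c → PerfectMatching G M
    → (∀ x y → c x ≢ c y → suc k + 4 ≤ 2 * (deg G x + deg G y))
    → AltHamCycle G M
theorem2p1 k G c M _ bipartite perfect degree-sum =
  alternating-hamilton-cycle G c M bipartite
    (spanning-alternating-cycle M M-partner M-unique degree-sum (proj₂ A-inhabited))
  where
  open PerfectMatching perfect
  m : Fin (suc k) → Fin (suc k)
  m x = proj₁ (covers x)
  M-partner : ∀ x → M x (m x) ≡ true
  M-partner x = proj₂ (covers x)
  M-unique : ∀ {x y} → M x y ≡ true → y ≡ m x
  M-unique {x} {y} e = disjoint x y (m x) e (M-partner x)
  open Digraph G c bipartite m (λ x → sym (M-unique (trans (M-sym (m x) x) (M-partner x))))
    (λ x → M⊆E x (m x) (M-partner x))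
  A-inhabited : ∃ A
  A-inhabited with c fzero in e
  ... | true  = fzero , e
  ... | false = m fzero , trans (Bool.¬-not (≢-sym (partner-colour fzero))) (cong not e)
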